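{- Let $n\equiv 2\pmod 4$. Let $E$ be a non-empty subset of $\{1,3,\dots,n-1\}$, let $I\subseteq\{0,1,\dots,n/2\}$, and suppose $E\cap\{i,n-i\}=\emptyset$ for all $i\in I$. Then the hypercube $Q_n$ admits a $D$-magic labeling for $$D=E\cup\bigcup_{i\in I}\{i,n-i\}.$$
   Context: The hypercube $Q_n$ has vertex set $\mathbb{F}_2^n$, two vertices adjacent iff they differ in exactly one coordinate; $d(x,y)$ is the graph distance. For a set of distances $D$ and a vertex $x$ of a graph $G$, $N_D(x)=\{y\in V(G): d(x,y)\in D\}$. For a graph $G$ of order $N$, a $D$-magic labeling is a bijection $f:V(G)\to\{1,\dots,N\}$ for which there exists a constant $k$ with $\sum_{y\in N_D(x)}f(y)=k$ for every vertex $x$. -}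

module Defs where

open import Data.Bool.Base using (Bool)
import Data.Bool.Properties as Bool
open import Data.Fin.Base using (Fin; zero; suc; toℕ; opposite)
import Data.Fin.Properties as Fin
open import Data.Fin.Subset using (Subset; _∈_; _∪_; ⁅_⁆; ⋃)
open import Data.Fin.Subset.Properties using (_∈?_)
open import Data.List.Base using (List; map; filter; allFin)
open import Data.Nat.Base using (ℕ; zero; suc; _≤_; _^_)
open import Data.Nat.ListAction using (sum)
open import Data.Nat.Properties using (≮⇒≥; ≤⇒≯; allUpTo?)
open import Data.Product using (Σ; ∃; ∃!; _×_; _,_; uncurry)
open import Data.Product.Function.NonDependent.Propositional using (_×-↔_)
open import Data.Vec.Base using (Vec; []; _∷_; lookup)
open import Function.Base using (_∘_)
open import Function.Bundles using (_↔_; _⤖_; Inverse; Bijection; mk↔ₛ′)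
open import Function.Construct.Composition using (_↔-∘_)
open import Function.Properties.Inverse using (↔⇒↣; ↔-sym)
open import Relation.Binary.Definitions using (Decidable; Symmetric; DecidableEquality)
open import Relation.Binary.PropositionalEquality using (_≡_; _≢_; refl; sym; subst)
open import Relation.Nullary.Decidable using (Dec; map′; ¬?; _×-dec_; _→-dec_; via-injection)
open import Relation.Nullary.Negation using (¬_)

record FiniteGraph : Set₁ where
  field
    Vertex      : Set
    order       : ℕ
    enumeration : Fin order ↔ Vertex
    _~_         : Vertex → Vertex → Set
    ~-dec       : Decidable _~_
    ~-sym       : Symmetric _~_
    ~-irrefl    : ∀ {x} → ¬ (x ~ x)

  vertices : List Vertex
  vertices = map (Inverse.to enumeration) (allFin order)

  _≟V_ : DecidableEquality Vertex
  _≟V_ = via-injection (↔⇒↣ (↔-sym enumeration)) Fin._≟_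

  someVertex? : {P : Vertex → Set} → (∀ v → Dec (P v)) → Dec (∃ P)
  someVertex? {P} P? = map′
    (λ (i , p) → Inverse.to enumeration i , p)
    (λ (v , p) → Inverse.from enumeration v ,
                 subst P (sym (Inverse.strictlyInverseˡ enumeration v)) p)
    (Fin.any? (P? ∘ Inverse.to enumeration))

  data Walk : ℕ → Vertex → Vertex → Set where
    stay : ∀ {x} → Walk 0 x x
    step : ∀ {k x y z} → x ~ y → Walk k y z → Walk (suc k) x z

  walk? : ∀ k x y → Dec (Walk k x y)
  walk? zero x y = map′ (λ { refl → stay }) (λ { stay → refl }) (x ≟V y)
  walk? (suc k) x z = map′
    (λ (_ , a , w) → step a w)
    (λ { (step a w) → _ , a , w })
    (someVertex? (λ y → ~-dec x y ×-dec walk? k y z))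

  -- d(x,y) = d; a relation, since no distance exists between different components.
  IsDistance : Vertex → Vertex → ℕ → Set
  IsDistance x y d = Walk d x y × (∀ {e} → Walk e x y → d ≤ e)

  isDistance? : ∀ x y d → Dec (IsDistance x y d)
  isDistance? x y d = walk? d x y ×-dec map′
    (λ none {e} w → ≮⇒≥ (λ e<d → none e<d w))
    (λ least {e} e<d w → ≤⇒≯ (least w) e<d)
    (allUpTo? (λ e → ¬? (walk? e x y)) d)

  N : ∀ {m} → Subset m → Vertex → Vertex → Set
  N D x y = ∃ λ d → d ∈ D × IsDistance x y (toℕ d)

  N? : ∀ {m} (D : Subset m) x y → Dec (N D x y)
  N? D x y = Fin.any? (λ d → (d ∈? D) ×-dec isDistance? x y (toℕ d))

  -- Σ_{y ∈ N_D(x)} f(y)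
  neighbourhoodSum : ∀ {m} → Subset m → (Vertex → ℕ) → Vertex → ℕ
  neighbourhoodSum D f x = sum (map f (filter (N? D x) vertices))

  -- Bijections onto {1,…,N} are bijections onto Fin N = {0,…,N-1} shifted by one.
  label : Vertex ⤖ Fin order → Vertex → ℕ
  label f v = suc (toℕ (Bijection.to f v))

  IsMagic : ∀ {m} → Subset m → Vertex ⤖ Fin order → Set
  IsMagic D f = ∃ λ k → ∀ x → neighbourhoodSum D (label f) x ≡ k

AdmitsMagicLabeling : (G : FiniteGraph) → ∀ {m} → Subset m → Set
AdmitsMagicLabeling G D = Σ (Vertex ⤖ Fin order) (IsMagic D)
  where open FiniteGraph G

DifferInOne : ∀ {n} → Vec Bool n → Vec Bool n → Set
DifferInOne x y = ∃! _≡_ (λ i → lookup x i ≢ lookup y i)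

differInOne? : ∀ {n} → Decidable (DifferInOne {n})
differInOne? x y = map′
  (λ (i , d , u) → i , d , λ {j} → u j)
  (λ (i , d , u) → i , d , λ j → u {j})
  (Fin.any? (λ i → differ? i ×-dec Fin.all? (λ j → differ? j →-dec (i Fin.≟ j))))
  where
  differ? : ∀ i → Dec (lookup x i ≢ lookup y i)
  differ? i = ¬? (lookup x i Bool.≟ lookup y i)

Fin2^n↔Vec : ∀ n → Fin (2 ^ n) ↔ Vec Bool n
Fin2^n↔Vec zero = mk↔ₛ′ (λ _ → []) (λ _ → zero) (λ { [] → refl }) (λ { zero → refl })
Fin2^n↔Vec (suc n) = cons ↔-∘ ((Fin.2↔Bool ×-↔ Fin2^n↔Vec n) ↔-∘ Fin.*↔× {2} {2 ^ n})
  where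
  cons : (Bool × Vec Bool n) ↔ Vec Bool (suc n)
  cons = mk↔ₛ′ (uncurry _∷_) (λ { (b ∷ v) → b , v }) (λ { (_ ∷ _) → refl }) (λ _ → refl)

Q : ℕ → FiniteGraph
Q n = record
  { Vertex      = Vec Bool n
  ; order       = 2 ^ n
  ; enumeration = Fin2^n↔Vec n
  ; _~_         = DifferInOne
  ; ~-dec       = differInOne?
  ; ~-sym       = λ (i , d , u) → i , d ∘ sym , λ d′ → u (d′ ∘ sym)
  ; ~-irrefl    = λ (_ , d , _) → d refl
  }

-- {i, n - i} in {0,…,n}: on Fin (suc n), opposite is i ↦ n - i.
mirrorPair : ∀ {n} → Fin (suc n) → Subset (suc n)
mirrorPair i = ⁅ i ⁆ ∪ ⁅ opposite i ⁆

-- ⋃_{i ∈ I} F(i)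
⋃[_] : ∀ {m n} → Subset m → (Fin m → Subset n) → Subset n
⋃[ I ] F = ⋃ (map F (filter (_∈? I) (allFin _)))

{-# OPTIONS --safe #-}
-- Label y ∈ F₂ⁿ by the number whose binary digits are r · y, with r running over a basis of
-- F₂ⁿ consisting of vectors of weight m = n/2.  It suffices that, for each such r, as many
-- z with ∣z∣ ∈ D satisfy r · z = 0 as satisfy r · z = 1.  For even ∣z∣ complementation
-- z ↦ ∁ z preserves D and flips r · z because m is odd; for odd ∣z∣ exchanging the support of
-- r with its complement (both of size m) preserves ∣z∣ and flips r · z.
module Submission where

open import Defs
open import Algebra.Properties.CommutativeSemigroup using (interchange)
open import Data.Bool.Base using (Bool; true; false; not; _xor_; if_then_else_)
import Data.Bool.Properties as Bool
open import Data.Fin.Base using (Fin; zero; suc; toℕ; opposite; punchOut; combine; _↑ˡ_; _↑ʳ_)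
import Data.Fin.Properties as Fin
open import Data.Fin.Subset using (Subset; _∈_; _∪_; _∩_; Nonempty; Empty; ∣_∣; ∁; ⊤; ⊥; ⁅_⁆; ⋃)
open import Data.Fin.Subset.Properties using (_∈?_; ∉⊥; x∈p∪q⁻; x∈p∪q⁺; x∈⁅x⁆; x∈⁅y⁆⇒x≡y; ∣⊥∣≡0; ∣⊤∣≡n; ∣⁅x⁆∣≡1; ∣p∣≤∣x∷p∣; ∩-identityˡ)
open import Data.List.Base as List using (List; []; _∷_; allFin)
import Data.List.Properties as List
open import Data.List.Membership.Propositional using () renaming (_∈_ to _∈ₗ_)
open import Data.List.Membership.Propositional.Properties using (∈-map⁻)
open import Data.List.Relation.Unary.Any using (here; there)
open import Data.Nat.Base using (ℕ; zero; suc; _+_; _*_; _≤_; _∸_; _/_; _%_; _^_; s≤s)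
open import Data.Nat.DivMod using (m≡m%n+[m/n]*n; [m+kn]%n≡m%n)
open import Data.Nat.ListAction using (sum)
open import Data.Nat.Properties
open import Data.Nat.Tactic.RingSolver using (solve-∀)
open import Data.Product.Base using (∃; _×_; _,_; proj₁)
open import Data.Sum.Base using (_⊎_; inj₁; inj₂)
open import Data.Vec.Base using (Vec; []; _∷_; _++_; map; zipWith; lookup; replicate; tabulate; splitAt)
open import Data.Vec.Properties using (∷-injective; lookup-replicate)
open import Data.Vec.Relation.Binary.Pointwise.Extensional using (ext; Pointwise-≡⇒≡)
open import Data.Vec.Relation.Unary.All as All using (All; []; _∷_)
import Data.Vec.Relation.Unary.All.Properties as All
open import Function.Base using (_∘_; flip)
open import Function.Bundles using (_⤖_; _⇔_; Inverse; mk⤖; mk⇔)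
open import Function.Definitions using (Injective; StrictlySurjective)
open import Function.Consequences.Propositional using (strictlySurjective⇒surjective)
open import Relation.Binary.PropositionalEquality
open import Relation.Nullary.Decidable using (yes; no; does; does-⇔; _×-dec_; decidable-stable)
open import Relation.Nullary.Negation using (contradiction)
open import Relation.Unary using (Decidable)

open ≡-Reasoning

private
  variable
    A : Set
    k l m n : ℕ

  +-interchange : ∀ a b c d → (a + b) + (c + d) ≡ (a + c) + (b + d)
  +-interchange = interchange +-commutativeSemigroup

-- Preliminaries on finite sets and parity

injective⇒surjective : {f : Fin n → Fin n} → Injective _≡_ _≡_ f → StrictlySurjective _≡_ f
injective⇒surjective {suc n} {f} inj y with Fin.any? (λ x → f x Fin.≟ y)
... | yes found = found
-- Deleting the missed value `y` from the codomain would turn `f` into an injection of `Fin (suc n)`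
-- into `Fin n`.
... | no  missed = contradiction
  (Fin.injective⇒≤ {f = λ x → punchOut (y≢f x)}
    (λ {x} {x′} → inj ∘ Fin.punchOut-injective (y≢f x) (y≢f x′)))
  1+n≰n
  where
  y≢f : ∀ x → y ≢ f x
  y≢f x eq = missed (x , sym eq)

lookup-injective : {xs ys : Vec A n} → (∀ i → lookup xs i ≡ lookup ys i) → xs ≡ ys
lookup-injective eq = Pointwise-≡⇒≡ (ext eq)

odd : ℕ → Bool
odd zero    = false
odd (suc n) = not (odd n)

odd-+ : ∀ m n → odd (m + n) ≡ odd m xor odd n
odd-+ zero    n = refl
odd-+ (suc m) n = trans (cong not (odd-+ m n)) (Bool.not-distribˡ-xor (odd m) (odd n))

odd-double : ∀ n → odd (n + n) ≡ false
odd-double n = trans (odd-+ n n) (Bool.xor-same (odd n))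

odd-complement : ∀ m n → odd (m + n) ≡ true → odd m ≡ not (odd n)
odd-complement m n eq with odd m | odd n | trans (sym (odd-+ m n)) eq
... | true  | false | _ = refl
... | false | true  | _ = refl

%2≡1⇒odd : ∀ n → n % 2 ≡ 1 → odd n ≡ true
%2≡1⇒odd 1             _  = refl
%2≡1⇒odd (suc (suc n)) eq = trans (Bool.not-involutive (odd n)) (%2≡1⇒odd n eq′)
  where
  eq′ : n % 2 ≡ 1
  eq′ = trans (sym (trans (cong (_% 2) (+-comm 2 n)) ([m+kn]%n≡m%n n 1 2))) eq

bit : Bool → ℕ
bit false = 0
bit true  = 1

-- Sums over the cube

infixl 6 _⊕_

_⊕_ : Vec Bool n → Vec Bool n → Vec Bool n
_⊕_ = zipWith _xor_

⊕-cancelˡ : (x y : Vec Bool n) → x ⊕ (x ⊕ y) ≡ y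
⊕-cancelˡ []          []      = refl
⊕-cancelˡ (false ∷ x) (b ∷ y) = cong (b ∷_) (⊕-cancelˡ x y)
⊕-cancelˡ (true  ∷ x) (b ∷ y) = cong₂ _∷_ (Bool.not-involutive b) (⊕-cancelˡ x y)

⊕-⊥ : (x : Vec Bool n) → x ⊕ ⊥ ≡ x
⊕-⊥ []      = refl
⊕-⊥ (b ∷ x) = cong₂ _∷_ (Bool.xor-identityʳ b) (⊕-⊥ x)

∑ : (Vec Bool n → ℕ) → ℕ
∑ {zero}  f = f []
∑ {suc n} f = ∑ (f ∘ (false ∷_)) + ∑ (f ∘ (true ∷_))

∑-cong : {f g : Vec Bool n → ℕ} → (∀ z → f z ≡ g z) → ∑ f ≡ ∑ g
∑-cong {zero}  eq = eq []
∑-cong {suc n} eq = cong₂ _+_ (∑-cong (eq ∘ (false ∷_))) (∑-cong (eq ∘ (true ∷_)))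

∑-+ : (f g : Vec Bool n → ℕ) → ∑ (λ z → f z + g z) ≡ ∑ f + ∑ g
∑-+ {zero}  f g = refl
∑-+ {suc n} f g = trans
  (cong₂ _+_ (∑-+ (f ∘ (false ∷_)) (g ∘ (false ∷_))) (∑-+ (f ∘ (true ∷_)) (g ∘ (true ∷_))))
  (+-interchange (∑ (f ∘ (false ∷_))) _ _ _)

∑-* : ∀ c (f : Vec Bool n → ℕ) → ∑ (λ z → c * f z) ≡ c * ∑ f
∑-* {zero}  c f = refl
∑-* {suc n} c f = trans
  (cong₂ _+_ (∑-* c (f ∘ (false ∷_))) (∑-* c (f ∘ (true ∷_))))
  (sym (*-distribˡ-+ c (∑ (f ∘ (false ∷_))) _))

-- Translation permutes the cube: a head bit `true` swaps the two subcubes, `false` keeps them.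
∑-shift : (x : Vec Bool n) (f : Vec Bool n → ℕ) → ∑ (f ∘ (x ⊕_)) ≡ ∑ f
∑-shift []          f = refl
∑-shift (false ∷ x) f = cong₂ _+_ (∑-shift x (f ∘ (false ∷_))) (∑-shift x (f ∘ (true ∷_)))
∑-shift (true  ∷ x) f = trans
  (cong₂ _+_ (∑-shift x (f ∘ (true ∷_))) (∑-shift x (f ∘ (false ∷_))))
  (+-comm (∑ (f ∘ (true ∷_))) _)

∑-∁ : (f : Vec Bool n → ℕ) → ∑ (f ∘ ∁) ≡ ∑ f
∑-∁ {zero}  f = refl
∑-∁ {suc n} f = trans
  (cong₂ _+_ (∑-∁ (f ∘ (true ∷_))) (∑-∁ (f ∘ (false ∷_))))
  (+-comm (∑ (f ∘ (true ∷_))) _)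

-- The number of z with u elements in a given a-set and v elements in a disjoint b-set does
-- not depend on these sets, so neither does the sum of G u v over all z.
∑ₐᵦ : ℕ → ℕ → (ℕ → ℕ → ℕ) → ℕ
∑ₐᵦ zero    zero    G = G 0 0
∑ₐᵦ zero    (suc b) G = ∑ₐᵦ zero b G + ∑ₐᵦ zero b (λ u v → G u (suc v))
∑ₐᵦ (suc a) b       G = ∑ₐᵦ a b G + ∑ₐᵦ a b (G ∘ suc)

-- `∑ₐᵦ` peels off `b` only once `a` is exhausted. Peeling from the two blocks commutes, so `b` may
-- also go first.
∑ₐᵦ-sucʳ : ∀ a b G → ∑ₐᵦ a (suc b) G ≡ ∑ₐᵦ a b G + ∑ₐᵦ a b (λ u v → G u (suc v))
∑ₐᵦ-sucʳ zero    b G = refl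
∑ₐᵦ-sucʳ (suc a) b G = trans
  (cong₂ _+_ (∑ₐᵦ-sucʳ a b G) (∑ₐᵦ-sucʳ a b (G ∘ suc)))
  (+-interchange (∑ₐᵦ a b G) _ _ _)

-- In closed form `∑ₐᵦ a b G` is the sum of C(a,u) C(b,v) G u v over all u and v, which treats the
-- two blocks alike.
∑ₐᵦ-flip : ∀ a b G → ∑ₐᵦ a b G ≡ ∑ₐᵦ b a (flip G)
∑ₐᵦ-flip zero    zero    G = refl
∑ₐᵦ-flip zero    (suc b) G = cong₂ _+_ (∑ₐᵦ-flip zero b G) (∑ₐᵦ-flip zero b _)
∑ₐᵦ-flip (suc a) b       G = trans
  (cong₂ _+_ (∑ₐᵦ-flip a b G) (∑ₐᵦ-flip a b (G ∘ suc)))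
  (sym (∑ₐᵦ-sucʳ b a (flip G)))

-- Each coordinate lies in exactly one of `r` and `∁ r`, so a set bit of `z` raises exactly one of
-- the two counts.
∑-bisection : (r : Subset n) (G : ℕ → ℕ → ℕ) →
              ∑ (λ z → G ∣ r ∩ z ∣ ∣ ∁ r ∩ z ∣) ≡ ∑ₐᵦ ∣ r ∣ ∣ ∁ r ∣ G
∑-bisection []          G = refl
∑-bisection (true  ∷ r) G = cong₂ _+_ (∑-bisection r G) (∑-bisection r (G ∘ suc))
∑-bisection (false ∷ r) G = trans
  (cong₂ _+_ (∑-bisection r G) (∑-bisection r (λ u v → G u (suc v))))
  (sym (∑ₐᵦ-sucʳ ∣ r ∣ ∣ ∁ r ∣ G))

-- Linear forms on F₂ⁿ

infix 7 _·_

-- The dot product over F₂. As the parity of a cardinality it inherits the counting identities for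
-- `∣_∣`.
_·_ : Subset n → Vec Bool n → Bool
r · z = odd ∣ r ∩ z ∣

·-⊕ : (r : Subset n) (x y : Vec Bool n) → r · (x ⊕ y) ≡ (r · x) xor (r · y)
·-⊕ []          []          []          = refl
·-⊕ (false ∷ r) (_     ∷ x) (_     ∷ y) = ·-⊕ r x y
·-⊕ (true  ∷ r) (false ∷ x) (false ∷ y) = ·-⊕ r x y
·-⊕ (true  ∷ r) (false ∷ x) (true  ∷ y) =
  trans (cong not (·-⊕ r x y)) (Bool.not-distribʳ-xor (r · x) (r · y))
·-⊕ (true  ∷ r) (true  ∷ x) (false ∷ y) =
  trans (cong not (·-⊕ r x y)) (Bool.not-distribˡ-xor (r · x) (r · y))
·-⊕ (true  ∷ r) (true  ∷ x) (true  ∷ y) =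
  trans (·-⊕ r x y) (sym (Bool.xor-annihilates-not (r · x) (r · y)))

∣r∩z∣+∣∁r∩z∣≡∣z∣ : (r z : Subset n) → ∣ r ∩ z ∣ + ∣ ∁ r ∩ z ∣ ≡ ∣ z ∣
∣r∩z∣+∣∁r∩z∣≡∣z∣ []          []          = refl
∣r∩z∣+∣∁r∩z∣≡∣z∣ (true  ∷ r) (true  ∷ z) = cong suc (∣r∩z∣+∣∁r∩z∣≡∣z∣ r z)
∣r∩z∣+∣∁r∩z∣≡∣z∣ (false ∷ r) (true  ∷ z) = trans (+-suc ∣ r ∩ z ∣ _) (cong suc (∣r∩z∣+∣∁r∩z∣≡∣z∣ r z))
∣r∩z∣+∣∁r∩z∣≡∣z∣ (true  ∷ r) (false ∷ z) = ∣r∩z∣+∣∁r∩z∣≡∣z∣ r z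
∣r∩z∣+∣∁r∩z∣≡∣z∣ (false ∷ r) (false ∷ z) = ∣r∩z∣+∣∁r∩z∣≡∣z∣ r z

∣r∩z∣+∣r∩∁z∣≡∣r∣ : (r z : Subset n) → ∣ r ∩ z ∣ + ∣ r ∩ ∁ z ∣ ≡ ∣ r ∣
∣r∩z∣+∣r∩∁z∣≡∣r∣ []          []          = refl
∣r∩z∣+∣r∩∁z∣≡∣r∣ (true  ∷ r) (true  ∷ z) = cong suc (∣r∩z∣+∣r∩∁z∣≡∣r∣ r z)
∣r∩z∣+∣r∩∁z∣≡∣r∣ (true  ∷ r) (false ∷ z) = trans (+-suc ∣ r ∩ z ∣ _) (cong suc (∣r∩z∣+∣r∩∁z∣≡∣r∣ r z))
∣r∩z∣+∣r∩∁z∣≡∣r∣ (false ∷ r) (_     ∷ z) = ∣r∩z∣+∣r∩∁z∣≡∣r∣ r z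

∣z∣+∣∁z∣≡n : (z : Subset n) → ∣ z ∣ + ∣ ∁ z ∣ ≡ n
∣z∣+∣∁z∣≡n []          = refl
∣z∣+∣∁z∣≡n (true  ∷ z) = cong suc (∣z∣+∣∁z∣≡n z)
∣z∣+∣∁z∣≡n (false ∷ z) = trans (+-suc ∣ z ∣ _) (cong suc (∣z∣+∣∁z∣≡n z))

∣++∣ : (p : Subset m) (q : Subset n) → ∣ p ++ q ∣ ≡ ∣ p ∣ + ∣ q ∣
∣++∣ []          q = refl
∣++∣ (true  ∷ p) q = cong suc (∣++∣ p q)
∣++∣ (false ∷ p) q = ∣++∣ p q

·-++ : (p : Subset m) (q : Subset n) (x : Vec Bool m) (y : Vec Bool n) →
       (p ++ q) · (x ++ y) ≡ (p · x) xor (q · y)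
·-++ []          q []          y = refl
·-++ (false ∷ p) q (_     ∷ x) y = ·-++ p q x y
·-++ (true  ∷ p) q (false ∷ x) y = ·-++ p q x y
·-++ (true  ∷ p) q (true  ∷ x) y = trans (cong not (·-++ p q x y)) (Bool.not-distribˡ-xor (p · x) (q · y))

⊤· : (x : Vec Bool n) → ⊤ · x ≡ odd ∣ x ∣
⊤· x = cong (odd ∘ ∣_∣) (∩-identityˡ x)

⊥· : (x : Vec Bool n) → ⊥ · x ≡ false
⊥· []      = refl
⊥· (_ ∷ x) = ⊥· x

⊤++⊥· : (x : Vec Bool m) (y : Vec Bool n) → (⊤ {m} ++ ⊥ {n}) · (x ++ y) ≡ odd ∣ x ∣
⊤++⊥· x y = trans (·-++ ⊤ ⊥ x y)
  (trans (cong₂ _xor_ (⊤· x) (⊥· y)) (Bool.xor-identityʳ (odd ∣ x ∣)))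

⁅⁆· : (i : Fin n) (x : Vec Bool n) → ⁅ i ⁆ · x ≡ lookup x i
⁅⁆· zero    (false ∷ x) = ⊥· x
⁅⁆· zero    (true  ∷ x) = cong not (⊥· x)
⁅⁆· (suc i) (_     ∷ x) = ⁅⁆· i x

-- Once the parity of `x` is known, this recovers bit `i` from the left half `∁ ⁅ i ⁆` of an
-- exchange.
∁⁅⁆· : (i : Fin n) (x : Vec Bool n) → lookup x i xor (∁ ⁅ i ⁆ · x) ≡ odd ∣ x ∣
∁⁅⁆· i x = begin
  lookup x i xor (∁ ⁅ i ⁆ · x)           ≡⟨ cong (_xor (∁ ⁅ i ⁆ · x)) (⁅⁆· i x) ⟨
  (⁅ i ⁆ · x) xor (∁ ⁅ i ⁆ · x)          ≡⟨ odd-+ ∣ ⁅ i ⁆ ∩ x ∣ _ ⟨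
  odd (∣ ⁅ i ⁆ ∩ x ∣ + ∣ ∁ ⁅ i ⁆ ∩ x ∣)  ≡⟨ cong odd (∣r∩z∣+∣∁r∩z∣≡∣z∣ ⁅ i ⁆ x) ⟩
  odd ∣ x ∣                              ∎

-- Balanced linear forms

record IsBisection (r : Subset n) : Set where
  field
    ∣r∣≡∣∁r∣ : ∣ r ∣ ≡ ∣ ∁ r ∣
    odd-∣r∣  : odd ∣ r ∣ ≡ true

-- A weight `g` takes the place of the indicator of D, so that splitting D by parity becomes adding
-- two weights.
record Balanced (n : ℕ) (g : ℕ → ℕ) : Set where
  field
    balance : {r : Subset n} → IsBisection r →
      ∑ (λ z → g ∣ z ∣ * bit (r · z)) ≡ ∑ (λ z → g ∣ z ∣ * bit (not (r · z)))

open Balanced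

-- The summand depends on `z` only through its counts u in `r` and v in `∁ r`. Where u + v is odd,
-- exchanging u and v flips the parity of the first count; elsewhere `g` vanishes.
oddSupport⇒balanced : {g : ℕ → ℕ} → (∀ w → odd w ≡ false → g w ≡ 0) → Balanced n g
oddSupport⇒balanced {g = g} g-even .balance {r} bis = begin
  ∑ (λ z → g ∣ z ∣ * bit (r · z))            ≡⟨ ∑-cong (λ z → cong (λ w → g w * bit (r · z)) (sym (∣r∩z∣+∣∁r∩z∣≡∣z∣ r z))) ⟩
  ∑ (λ z → G ∣ r ∩ z ∣ ∣ ∁ r ∩ z ∣)          ≡⟨ ∑-bisection r G ⟩
  ∑ₐᵦ (∣ r ∣) (∣ ∁ r ∣) G                        ≡⟨ ∑ₐᵦ-flip (∣ r ∣) (∣ ∁ r ∣) G ⟩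
  -- The halves have equal size, so the sizes can be restored while `G` stays flipped.
  ∑ₐᵦ (∣ ∁ r ∣) (∣ r ∣) (flip G)                 ≡⟨ cong₂ (λ a b → ∑ₐᵦ a b (flip G)) ∣r∣≡∣∁r∣ (sym ∣r∣≡∣∁r∣) ⟨
  ∑ₐᵦ (∣ r ∣) (∣ ∁ r ∣) (flip G)                 ≡⟨ ∑-bisection r (flip G) ⟨
  ∑ (λ z → G ∣ ∁ r ∩ z ∣ ∣ r ∩ z ∣)          ≡⟨ ∑-cong (λ z → G-flip ∣ ∁ r ∩ z ∣ ∣ r ∩ z ∣) ⟩
  ∑ (λ z → g (∣ r ∩ z ∣ + ∣ ∁ r ∩ z ∣) * bit (not (r · z)))
                                             ≡⟨ ∑-cong (λ z → cong (λ w → g w * bit (not (r · z))) (∣r∩z∣+∣∁r∩z∣≡∣z∣ r z)) ⟩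
  ∑ (λ z → g ∣ z ∣ * bit (not (r · z)))      ∎
  where
  open IsBisection bis
  G : ℕ → ℕ → ℕ
  G u v = g (u + v) * bit (odd u)
  G-flip : ∀ u v → G u v ≡ g (v + u) * bit (not (odd v))
  G-flip u v with odd (u + v) in eq
  ... | true  = cong₂ _*_ (cong g (+-comm u v)) (cong bit (odd-complement u v eq))
  ... | false = trans
    (cong (_* bit (odd u)) (g-even (u + v) eq))
    (sym (cong (_* bit (not (odd v))) (g-even (v + u) (trans (cong odd (+-comm v u)) eq))))

-- Substitute `∁ z` for `z`: the weight w becomes n - w, which `g` does not see, and the form
-- changes its value.
symmetric⇒balanced : {g : ℕ → ℕ} → (∀ w w′ → w + w′ ≡ n → g w ≡ g w′) → Balanced n g
symmetric⇒balanced {g = g} g-sym .balance {r} bis = begin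
  ∑ (λ z → g ∣ z ∣ * bit (r · z))        ≡⟨ ∑-∁ (λ z → g ∣ z ∣ * bit (r · z)) ⟨
  ∑ (λ z → g ∣ ∁ z ∣ * bit (r · ∁ z))    ≡⟨ ∑-cong (λ z → cong₂ _*_ (sym (g-sym _ _ (∣z∣+∣∁z∣≡n z))) (cong bit (flips z))) ⟩
  ∑ (λ z → g ∣ z ∣ * bit (not (r · z)))  ∎
  where
  open IsBisection bis
  -- The elements of `r` are shared out between `z` and `∁ z`, and their number is odd.
  flips : ∀ z → r · ∁ z ≡ not (r · z)
  flips z = odd-complement ∣ r ∩ ∁ z ∣ ∣ r ∩ z ∣ (begin
    odd (∣ r ∩ ∁ z ∣ + ∣ r ∩ z ∣)  ≡⟨ cong odd (+-comm ∣ r ∩ ∁ z ∣ _) ⟩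
    odd (∣ r ∩ z ∣ + ∣ r ∩ ∁ z ∣)  ≡⟨ cong odd (∣r∩z∣+∣r∩∁z∣≡∣r∣ r z) ⟩
    odd ∣ r ∣                      ≡⟨ odd-∣r∣ ⟩
    true                           ∎)

balanced-+ : {g h : ℕ → ℕ} → Balanced n g → Balanced n h → Balanced n (λ w → g w + h w)
balanced-+ {n} {g} {h} bal-g bal-h .balance {r} bis = begin
  ∑ (λ z → (g ∣ z ∣ + h ∣ z ∣) * bit (r · z))
    ≡⟨ split (λ z → bit (r · z)) ⟩
  ∑ (λ z → g ∣ z ∣ * bit (r · z)) + ∑ (λ z → h ∣ z ∣ * bit (r · z))
    ≡⟨ cong₂ _+_ (balance bal-g bis) (balance bal-h bis) ⟩
  ∑ (λ z → g ∣ z ∣ * bit (not (r · z))) + ∑ (λ z → h ∣ z ∣ * bit (not (r · z)))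
    ≡⟨ split (λ z → bit (not (r · z))) ⟨
  ∑ (λ z → (g ∣ z ∣ + h ∣ z ∣) * bit (not (r · z)))
    ∎
  where
  split : (f : Vec Bool n → ℕ) →
          ∑ (λ z → (g ∣ z ∣ + h ∣ z ∣) * f z) ≡ ∑ (λ z → g ∣ z ∣ * f z) + ∑ (λ z → h ∣ z ∣ * f z)
  split f = trans (∑-cong (λ z → *-distribʳ-+ (f z) (g ∣ z ∣) (h ∣ z ∣))) (∑-+ (λ z → g ∣ z ∣ * f z) (λ z → h ∣ z ∣ * f z))

balanced-resp-≗ : {g h : ℕ → ℕ} → (∀ w → g w ≡ h w) → Balanced n g → Balanced n h
balanced-resp-≗ {n} {g} {h} eq bal .balance {r} bis = trans
  (sym (reweigh (λ z → bit (r · z))))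
  (trans (balance bal bis) (reweigh (λ z → bit (not (r · z)))))
  where
  reweigh : (f : Vec Bool n → ℕ) → ∑ (λ z → g ∣ z ∣ * f z) ≡ ∑ (λ z → h ∣ z ∣ * f z)
  reweigh f = ∑-cong (λ z → cong (_* f z) (eq ∣ z ∣))

-- Split `g` by the parity of the weight: the odd part is balanced by exchanging halves, the even
-- part by complementation.
evenSymmetric⇒balanced : odd n ≡ false → {g : ℕ → ℕ} →
  (∀ w w′ → w + w′ ≡ n → odd w ≡ false → g w ≡ g w′) → Balanced n g
evenSymmetric⇒balanced {n} n-even {g} g-sym =
  balanced-resp-≗ parts (balanced-+ (oddSupport⇒balanced vanishes) (symmetric⇒balanced even-sym))
  where
  oddPart evenPart : ℕ → ℕ
  oddPart  w = if odd w then g w else 0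
  evenPart w = if odd w then 0 else g w
  parts : ∀ w → oddPart w + evenPart w ≡ g w
  parts w with odd w
  ... | true  = +-identityʳ (g w)
  ... | false = refl
  vanishes : ∀ w → odd w ≡ false → oddPart w ≡ 0
  vanishes w eq rewrite eq = refl
  even-sym : ∀ w w′ → w + w′ ≡ n → evenPart w ≡ evenPart w′
  -- As `n` is even, `w` and `w′` have the same parity. For odd ones both sides are the default 0.
  even-sym w w′ w+w′≡n with odd w in eq | odd w′ | trans (sym (odd-+ w w′)) (trans (cong odd w+w′≡n) n-even)
  ... | true  | true  | _ = refl
  ... | false | false | _ = g-sym w w′ w+w′≡n eq

-- Binary values of families of balanced forms

-- The head is the most significant bit, to agree with `combine` in `Fin2^n↔Vec`.
value : Vec Bool k → ℕ
value []                = 0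
value {suc k} (b ∷ v) = 2 ^ k * bit b + value v

toℕ-from : (v : Vec Bool k) → toℕ (Inverse.from (Fin2^n↔Vec k) v) ≡ value v
toℕ-from         []      = refl
toℕ-from {suc k} (b ∷ v) = trans
  (Fin.toℕ-combine (Inverse.from Fin.2↔Bool b) (Inverse.from (Fin2^n↔Vec k) v))
  (cong₂ (λ c w → 2 ^ k * c + w) (toℕ-bit b) (toℕ-from v))
  where
  toℕ-bit : ∀ b → toℕ (Inverse.from Fin.2↔Bool b) ≡ bit b
  toℕ-bit false = refl
  toℕ-bit true  = refl

apply : Vec (Subset n) k → Vec Bool n → Vec Bool k
apply rs y = map (_· y) rs

-- By linearity the shift by `x` adds the constant `r · x` to the form. The constant 0 changes
-- nothing; the constant 1 negates the form, which is harmless by balance.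
∑-form-invariant : {g : ℕ → ℕ} → Balanced n g → {r : Subset n} → IsBisection r → ∀ x →
  ∑ (λ z → g ∣ z ∣ * bit (r · (x ⊕ z))) ≡ ∑ (λ z → g ∣ z ∣ * bit (r · z))
∑-form-invariant {g = g} bal {r} bis x = trans
  (∑-cong (λ z → cong (λ c → g ∣ z ∣ * bit c) (·-⊕ r x z)))
  (by-value (r · x))
  where
  by-value : ∀ c → ∑ (λ z → g ∣ z ∣ * bit (c xor (r · z))) ≡ ∑ (λ z → g ∣ z ∣ * bit (r · z))
  by-value false = refl
  by-value true  = sym (balance bal bis)

-- A binary value is a sum of its bits with fixed coefficients, so each digit can be treated on its
-- own.
∑-value-invariant : {g : ℕ → ℕ} → Balanced n g → {rs : Vec (Subset n) k} → All IsBisection rs → ∀ x →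
  ∑ (λ z → g ∣ z ∣ * value (apply rs (x ⊕ z))) ≡ ∑ (λ z → g ∣ z ∣ * value (apply rs z))
∑-value-invariant                 bal []           x = refl
∑-value-invariant {n} {suc k} {g} bal {r ∷ rs} (bis ∷ biss) x = begin
  ∑ (λ z → g ∣ z ∣ * (2 ^ k * bit (r · (x ⊕ z)) + value (apply rs (x ⊕ z))))
    ≡⟨ split (λ z → bit (r · (x ⊕ z))) (λ z → value (apply rs (x ⊕ z))) ⟩
  2 ^ k * ∑ (λ z → g ∣ z ∣ * bit (r · (x ⊕ z))) + ∑ (λ z → g ∣ z ∣ * value (apply rs (x ⊕ z)))
    ≡⟨ cong₂ (λ s t → 2 ^ k * s + t) (∑-form-invariant bal bis x) (∑-value-invariant bal biss x) ⟩
  2 ^ k * ∑ (λ z → g ∣ z ∣ * bit (r · z)) + ∑ (λ z → g ∣ z ∣ * value (apply rs z))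
    ≡⟨ split (λ z → bit (r · z)) (λ z → value (apply rs z)) ⟨
  ∑ (λ z → g ∣ z ∣ * (2 ^ k * bit (r · z) + value (apply rs z)))
    ∎
  where
  *-left-comm : ∀ a b c → a * (b * c) ≡ b * (a * c)
  *-left-comm a b c = trans (sym (*-assoc a b c)) (trans (cong (_* c) (*-comm a b)) (*-assoc b a c))
  split : (f h : Vec Bool n → ℕ) → ∑ (λ z → g ∣ z ∣ * (2 ^ k * f z + h z)) ≡
                  2 ^ k * ∑ (λ z → g ∣ z ∣ * f z) + ∑ (λ z → g ∣ z ∣ * h z)
  split f h = begin
    ∑ (λ z → g ∣ z ∣ * (2 ^ k * f z + h z))
      ≡⟨ ∑-cong (λ z → trans (*-distribˡ-+ (g ∣ z ∣) (2 ^ k * f z) (h z)) (cong (_+ g ∣ z ∣ * h z) (*-left-comm (g ∣ z ∣) (2 ^ k) (f z)))) ⟩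
    ∑ (λ z → 2 ^ k * (g ∣ z ∣ * f z) + g ∣ z ∣ * h z)
      ≡⟨ ∑-+ (λ z → 2 ^ k * (g ∣ z ∣ * f z)) (λ z → g ∣ z ∣ * h z) ⟩
    ∑ (λ z → 2 ^ k * (g ∣ z ∣ * f z)) + ∑ (λ z → g ∣ z ∣ * h z)
      ≡⟨ cong (_+ ∑ (λ z → g ∣ z ∣ * h z)) (∑-* (2 ^ k) (λ z → g ∣ z ∣ * f z)) ⟩
    2 ^ k * ∑ (λ z → g ∣ z ∣ * f z) + ∑ (λ z → g ∣ z ∣ * h z)
      ∎

-- A basis of bisections

bisection : odd m ≡ true → {r : Subset n} → ∣ r ∣ ≡ m → ∣ ∁ r ∣ ≡ m → IsBisection r
bisection m-odd refl eq = record { ∣r∣≡∣∁r∣ = sym eq ; odd-∣r∣ = m-odd }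

halves-bisection : odd m ≡ true → (p q : Subset m) → ∣ p ∣ + ∣ q ∣ ≡ m → IsBisection (p ++ q)
halves-bisection {m} m-odd p q eq = bisection m-odd ∣p++q∣≡m
  -- A set and its complement have `m + m` elements together, which leaves `m` for the complement.
  (+-cancelˡ-≡ m _ _ (trans (cong (_+ ∣ ∁ (p ++ q) ∣) (sym ∣p++q∣≡m)) (∣z∣+∣∁z∣≡n (p ++ q))))
  where
  ∣p++q∣≡m : ∣ p ++ q ∣ ≡ m
  ∣p++q∣≡m = trans (∣++∣ p q) eq

-- The left half of the coordinates with i exchanged for the element k of the right half.
exchange : Fin m → Fin m → Subset (m + m)
exchange i k = ∁ ⁅ i ⁆ ++ ⁅ k ⁆

-- The pair (`zero`, `zero`) is left to `rightExchanges`. With `⊤ ++ ⊥` this makes 1 + l + (l + 1)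
-- rows, as many as there are coordinates.
leftExchanges : ∀ l → Vec (Subset (suc l + suc l)) l
leftExchanges l = tabulate (λ i → exchange (suc i) zero)

rightExchanges : ∀ l → Vec (Subset (suc l + suc l)) (suc l)
rightExchanges l = tabulate (λ k → exchange zero k)

-- The differences with ⊤ ++ ⊥ are the edges of a spanning tree of K_{m,m}, hence they span
-- the even-weight vectors; ⊤ ++ ⊥ itself has odd weight m.
basis : ∀ l → Vec (Subset (suc l + suc l)) (suc l + suc l)
basis l = (⊤ {suc l} ++ ⊥ {suc l}) ∷ (leftExchanges l ++ rightExchanges l)

basis-bisections : odd (suc l) ≡ true → All IsBisection (basis l)
basis-bisections {l} m-odd =
  halves-bisection m-odd ⊤ ⊥ (trans (cong₂ _+_ (∣⊤∣≡n (suc l)) (∣⊥∣≡0 (suc l))) (+-identityʳ (suc l))) ∷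
  All.++⁺ (All.tabulate⁺ (λ i → exchange-bisection (suc i) zero)) (All.tabulate⁺ (exchange-bisection zero))
  where
  exchange-bisection : ∀ i k → IsBisection (exchange i k)
  exchange-bisection i k = halves-bisection m-odd (∁ ⁅ i ⁆) ⁅ k ⁆ (begin
    ∣ ∁ ⁅ i ⁆ ∣ + ∣ ⁅ k ⁆ ∣  ≡⟨ cong (∣ ∁ ⁅ i ⁆ ∣ +_) (trans (∣⁅x⁆∣≡1 k) (sym (∣⁅x⁆∣≡1 i))) ⟩
    ∣ ∁ ⁅ i ⁆ ∣ + ∣ ⁅ i ⁆ ∣  ≡⟨ +-comm ∣ ∁ ⁅ i ⁆ ∣ _ ⟩
    ∣ ⁅ i ⁆ ∣ + ∣ ∁ ⁅ i ⁆ ∣  ≡⟨ ∣z∣+∣∁z∣≡n ⁅ i ⁆ ⟩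
    suc l                    ∎)

-- Write v as `x ++ y`. The row `⊤ ++ ⊥` makes `∣ x ∣` even, and then each exchange row equates a
-- bit of `x` with a bit of `y`. These equations connect all coordinates, so v is constant; all ones
-- is excluded because `∣ x ∣` would be the odd number `suc l`.
basis-kernel : odd (suc l) ≡ true → (v : Vec Bool (suc l + suc l)) →
               All (λ r → r · v ≡ false) (basis l) → v ≡ ⊥
basis-kernel {l} m-odd v (r₀·v ∷ rs·v) with splitAt (suc l) v
... | x , y , refl = trans (cong₂ _++_ (constant {x} x≡c) (constant {y} y≡c)) (⊥-++ (suc l))
  where
  ⊥-++ : ∀ m → ⊥ {m} ++ ⊥ {n} ≡ ⊥
  ⊥-++ zero    = refl
  ⊥-++ (suc m) = cong (false ∷_) (⊥-++ m)
  c : Bool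
  c = lookup x zero
  odd-∣x∣ : odd ∣ x ∣ ≡ false
  odd-∣x∣ = trans (sym (⊤++⊥· x y)) r₀·v
  xor≡false : ∀ a b → a xor b ≡ false → a ≡ b
  xor≡false false b     eq = sym eq
  xor≡false true  true  eq = refl
  exchange⇒≡ : ∀ i k → exchange i k · (x ++ y) ≡ false → lookup x i ≡ lookup y k
  -- Even `∣ x ∣` turns `lookup x i` into `∁ ⁅ i ⁆ · x`, and the vanishing exchange form turns that
  -- into `⁅ k ⁆ · y`.
  exchange⇒≡ i k eq = trans
    (xor≡false _ _ (trans (∁⁅⁆· i x) odd-∣x∣))
    (trans (xor≡false _ _ (trans (sym (·-++ (∁ ⁅ i ⁆) ⁅ k ⁆ x y)) eq)) (⁅⁆· k y))
  y≡c : ∀ k → lookup y k ≡ c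
  y≡c k = sym (exchange⇒≡ zero k (All.tabulate⁻ {f = exchange zero} (All.++ʳ⁻ (leftExchanges l) rs·v) k))
  x≡c : ∀ i → lookup x i ≡ c
  x≡c zero    = refl
  x≡c (suc i) = trans
    (exchange⇒≡ (suc i) zero (All.tabulate⁻ (All.++ˡ⁻ (leftExchanges l) rs·v) i))
    (y≡c zero)
  replicated : ∀ {z : Vec Bool (suc l)} {d} → (∀ i → lookup z i ≡ d) → z ≡ replicate (suc l) d
  replicated eq = lookup-injective (λ i → trans (eq i) (sym (lookup-replicate i _)))
  -- The common bit is abstracted to `d` so that it can be matched on.
  c≡false : ∀ d → (∀ i → lookup x i ≡ d) → d ≡ false
  c≡false false _  = refl
  c≡false true  eq = begin
    true               ≡⟨ m-odd ⟨
    odd (suc l)        ≡⟨ cong odd (∣⊤∣≡n (suc l)) ⟨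
    odd ∣ ⊤ {suc l} ∣  ≡⟨ cong (λ z → odd ∣ z ∣) {x} {⊤} (replicated eq) ⟨
    odd ∣ x ∣          ≡⟨ odd-∣x∣ ⟩
    false              ∎
  constant : {z : Vec Bool (suc l)} → (∀ i → lookup z i ≡ c) → z ≡ ⊥
  constant eq = trans (replicated eq) (cong (replicate (suc l)) (c≡false c x≡c))

map≡⇒All : {B : Set} {f g : A → B} (xs : Vec A k) → map f xs ≡ map g xs → All (λ x → f x ≡ g x) xs
map≡⇒All []       _  = []
map≡⇒All (x ∷ xs) eq with eq₁ , eq₂ ← ∷-injective eq = eq₁ ∷ map≡⇒All xs eq₂

-- A linear map with trivial kernel: over F₂ the difference of `x` and `y` is `x ⊕ y`.
apply-basis-injective : odd (suc l) ≡ true → Injective _≡_ _≡_ (apply (basis l))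
apply-basis-injective {l} m-odd {x} {y} eq = begin
  x            ≡⟨ ⊕-⊥ x ⟨
  x ⊕ ⊥        ≡⟨ cong (x ⊕_) x⊕y≡⊥ ⟨
  x ⊕ (x ⊕ y)  ≡⟨ ⊕-cancelˡ x y ⟩
  y            ∎
  where
  x⊕y≡⊥ : x ⊕ y ≡ ⊥
  x⊕y≡⊥ = basis-kernel m-odd (x ⊕ y) (All.map
    (λ {r} r·x≡r·y → trans (·-⊕ r x y) (trans (cong (_xor (r · y)) r·x≡r·y) (Bool.xor-same (r · y))))
    (map≡⇒All (basis l) eq))

injective⇒labeling : (f : Vec Bool n → Vec Bool n) → Injective _≡_ _≡_ f → Vec Bool n ⤖ Fin (2 ^ n)
injective⇒labeling {n} f f-inj = mk⤖ (from-inj , strictlySurjective⇒surjective surj)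
  where
  open Inverse (Fin2^n↔Vec n)
  to-inj : Injective _≡_ _≡_ to
  to-inj {i} {j} eq = trans (sym (strictlyInverseʳ i)) (trans (cong from eq) (strictlyInverseʳ j))
  from-inj : Injective _≡_ _≡_ (from ∘ f)
  from-inj {x} {y} eq = f-inj
    (trans (sym (strictlyInverseˡ (f x))) (trans (cong to eq) (strictlyInverseˡ (f y))))
  surj : StrictlySurjective _≡_ (from ∘ f)
  -- Composing with `to` first gives an endomap of `Fin (2 ^ n)`, where injectivity is enough.
  surj i with j , eq ← injective⇒surjective (to-inj ∘ from-inj) i = to j , eq

-- Distances and neighbourhood sums

module _ {n : ℕ} where
  open FiniteGraph (Q n) public using () renaming (Walk to CubeWalk)

-- Any other differing index would break uniqueness, and equality of bits is decidable, so the
-- remaining bits agree.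
differ-∷⁻ : ∀ {a b} {x y : Vec Bool n} → DifferInOne (a ∷ x) (b ∷ y) → x ≡ y ⊎ (a ≡ b × DifferInOne x y)
differ-∷⁻ {x = x} {y} (zero , _ , unique) = inj₁ (lookup-injective λ j →
  decidable-stable (lookup x j Bool.≟ lookup y j) (λ x≢y → contradiction (unique {suc j} x≢y) λ ()))
differ-∷⁻ {a = a} {b} (suc i , x≢y , unique) = inj₂
  ( decidable-stable (a Bool.≟ b) (λ a≢b → contradiction (unique {zero} a≢b) λ ())
  , i , x≢y , λ x≢y′ → Fin.suc-injective (unique x≢y′) )

∣b∷p∣≤1+∣p∣ : ∀ b (p : Subset n) → ∣ b ∷ p ∣ ≤ suc ∣ p ∣
∣b∷p∣≤1+∣p∣ false p = n≤1+n ∣ p ∣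
∣b∷p∣≤1+∣p∣ true  p = ≤-refl

-- An edge alters a single bit of `x ⊕ z`. Iterated along a walk, this bounds its length from below.
adjacent⇒∣⊕∣≤ : (x y z : Vec Bool n) → DifferInOne x y → ∣ x ⊕ z ∣ ≤ suc ∣ y ⊕ z ∣
adjacent⇒∣⊕∣≤ (a ∷ x) (b ∷ y) (c ∷ z) adj with differ-∷⁻ adj
... | inj₁ refl = ≤-trans (∣b∷p∣≤1+∣p∣ (a xor c) (x ⊕ z)) (s≤s (∣p∣≤∣x∷p∣ (b xor c) (x ⊕ z)))
... | inj₂ (refl , adj′) with a xor c
...   | true  = s≤s (adjacent⇒∣⊕∣≤ x y z adj′)
...   | false = adjacent⇒∣⊕∣≤ x y z adj′

x⊕x≡⊥ : (x : Vec Bool n) → x ⊕ x ≡ ⊥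
x⊕x≡⊥ []      = refl
x⊕x≡⊥ (b ∷ x) = cong₂ _∷_ (Bool.xor-same b) (x⊕x≡⊥ x)

walk⇒∣⊕∣≤ : {x y : Vec Bool n} → CubeWalk k x y → ∣ x ⊕ y ∣ ≤ k
walk⇒∣⊕∣≤ {n} {x = x} FiniteGraph.stay = ≤-reflexive (trans (cong ∣_∣ (x⊕x≡⊥ x)) (∣⊥∣≡0 n))
walk⇒∣⊕∣≤ {x = x} {z} (FiniteGraph.step {y = y} adj w) = ≤-trans (adjacent⇒∣⊕∣≤ x y z adj) (s≤s (walk⇒∣⊕∣≤ w))

walk-∷ : ∀ b {x y : Vec Bool n} → CubeWalk k x y → CubeWalk k (b ∷ x) (b ∷ y)
walk-∷ b FiniteGraph.stay = FiniteGraph.stay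
walk-∷ b (FiniteGraph.step (i , x≢y , unique) w) = FiniteGraph.step
  (suc i , x≢y , λ { {zero} b≢b → contradiction refl b≢b ; {suc j} x≢y′ → cong suc (unique x≢y′) })
  (walk-∷ b w)

-- Correct the differing coordinates one at a time, the head first; this attains the lower bound.
shortestWalk : (x y : Vec Bool n) → CubeWalk ∣ x ⊕ y ∣ x y
shortestWalk []      []      = FiniteGraph.stay
shortestWalk (a ∷ x) (b ∷ y) = prepend a b (shortestWalk x y)
  where
  flipHead : ∀ {a b} → a ≢ b → DifferInOne (a ∷ x) (b ∷ x)
  flipHead a≢b = zero , a≢b , λ { {zero} _ → refl ; {suc j} x≢x → contradiction refl x≢x }
  prepend : ∀ a b → CubeWalk ∣ x ⊕ y ∣ x y → CubeWalk ∣ (a ∷ x) ⊕ (b ∷ y) ∣ (a ∷ x) (b ∷ y)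
  prepend false false w = walk-∷ false w
  prepend true  true  w = walk-∷ true w
  prepend false true  w = FiniteGraph.step (flipHead λ ()) (walk-∷ true w)
  prepend true  false w = FiniteGraph.step (flipHead λ ()) (walk-∷ false w)

isDistance⇒∣⊕∣ : (x y : Vec Bool n) → FiniteGraph.IsDistance (Q n) x y k → k ≡ ∣ x ⊕ y ∣
isDistance⇒∣⊕∣ x y (w , least) = ≤-antisym (least (shortestWalk x y)) (walk⇒∣⊕∣≤ w)

∣⊕∣-isDistance : (x y : Vec Bool n) → FiniteGraph.IsDistance (Q n) x y ∣ x ⊕ y ∣
∣⊕∣-isDistance x y = shortestWalk x y , walk⇒∣⊕∣≤

-- Membership is stated for arbitrary naturals, so that a weight needs no proof of being below `m`.
Contains : Subset m → ℕ → Set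
Contains D w = ∃ λ d → d ∈ D × toℕ d ≡ w

contains? : (D : Subset m) → Decidable (Contains D)
contains? D w = Fin.any? (λ d → (d ∈? D) ×-dec (toℕ d ≟ w))

indicator : Subset m → ℕ → ℕ
indicator D w = bit (does (contains? D w))

N⇔contains : (D : Subset m) (x y : Vec Bool n) → FiniteGraph.N (Q n) D x y ⇔ Contains D ∣ x ⊕ y ∣
N⇔contains {n = n} D x y = mk⇔
  (λ (d , d∈D , dist) → d , d∈D , isDistance⇒∣⊕∣ x y dist)
  (λ (d , d∈D , eq) → d , d∈D , subst (FiniteGraph.IsDistance (Q n) x y) (sym eq) (∣⊕∣-isDistance x y))

sum-filter : {P : A → Set} (P? : Decidable P) (f : A → ℕ) (xs : List A) →
  sum (List.map f (List.filter P? xs)) ≡ sum (List.map (λ x → bit (does (P? x)) * f x) xs)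
sum-filter P? f []       = refl
sum-filter P? f (x ∷ xs) with does (P? x)
... | true  = cong₂ _+_ (sym (+-identityʳ (f x))) (sum-filter P? f xs)
... | false = sum-filter P? f xs

sum-tabulate-+ : ∀ m {n} (f : Fin (m + n) → ℕ) →
  sum (List.tabulate f) ≡ sum (List.tabulate (f ∘ (_↑ˡ n))) + sum (List.tabulate (f ∘ (m ↑ʳ_)))
sum-tabulate-+ zero    f = refl
sum-tabulate-+ (suc m) f = trans
  (cong (f zero +_) (sum-tabulate-+ m (f ∘ suc)))
  (sym (+-assoc (f zero) _ _))

-- The enumeration lists all vectors with head `false` before those with head `true`, just as `∑`
-- recurses.
sum-vertices : ∀ n (f : Vec Bool n → ℕ) → sum (List.map f (FiniteGraph.vertices (Q n))) ≡ ∑ f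
sum-vertices n f = begin
  sum (List.map f (List.map to (allFin (2 ^ n))))  ≡⟨ cong (sum ∘ List.map f) (List.map-tabulate (λ i → i) to) ⟩
  sum (List.map f (List.tabulate to))              ≡⟨ cong sum (List.map-tabulate to f) ⟩
  sum (List.tabulate (f ∘ to))                     ≡⟨ sum-tabulate n f ⟩
  ∑ f                                              ∎
  where
  open Inverse (Fin2^n↔Vec n) using (to)
  sum-tabulate : ∀ n (f : Vec Bool n → ℕ) → sum (List.tabulate (f ∘ Inverse.to (Fin2^n↔Vec n))) ≡ ∑ f
  sum-tabulate zero    f = +-identityʳ (f [])
  sum-tabulate (suc n) f = begin
    sum (List.tabulate g)
      ≡⟨ sum-tabulate-+ (2 ^ n) {1 * 2 ^ n} g ⟩
    sum (List.tabulate (g₂ zero)) + sum (List.tabulate (λ i → g (2 ^ n ↑ʳ i)))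
      -- `2 ^ suc n` unfolds to `2 ^ n + (2 ^ n + 0)`: the second block is followed by an empty one.
      ≡⟨ cong (sum (List.tabulate (g₂ zero)) +_)
           (trans (sum-tabulate-+ (2 ^ n) {0} (λ i → g (2 ^ n ↑ʳ i))) (+-identityʳ _)) ⟩
    sum (List.tabulate (g₂ zero)) + sum (List.tabulate (g₂ (suc zero)))
      ≡⟨ cong₂ (λ s t → sum s + sum t) (List.tabulate-cong (half zero)) (List.tabulate-cong (half (suc zero))) ⟩
    sum (List.tabulate (f ∘ (false ∷_) ∘ to′)) + sum (List.tabulate (f ∘ (true ∷_) ∘ to′))
      ≡⟨ cong₂ _+_ (sum-tabulate n (f ∘ (false ∷_))) (sum-tabulate n (f ∘ (true ∷_))) ⟩
    ∑ f
      ∎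
    where
    open Inverse (Fin2^n↔Vec n) using () renaming (to to to′)
    g : Fin (2 ^ suc n) → ℕ
    g = f ∘ Inverse.to (Fin2^n↔Vec (suc n))
    g₂ : Fin 2 → Fin (2 ^ n) → ℕ
    g₂ b i = g (combine b i)
    half : ∀ b i → g₂ b i ≡ f (Inverse.to Fin.2↔Bool b ∷ to′ i)
    half b i = cong (λ (b , i) → f (Inverse.to Fin.2↔Bool b ∷ to′ i)) (Fin.remQuot-combine b i)

-- Reparametrising by y = `x ⊕ z` makes the selection of summands independent of `x`, which is left
-- only in the argument of `f`.
neighbourhoodSum≡∑ : (D : Subset m) (f : Vec Bool n → ℕ) (x : Vec Bool n) →
  FiniteGraph.neighbourhoodSum (Q n) D f x ≡ ∑ (λ z → indicator D ∣ z ∣ * f (x ⊕ z))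
neighbourhoodSum≡∑ {n = n} D f x = begin
  neighbourhoodSum D f x
    ≡⟨ sum-filter (N? D x) f vertices ⟩
  sum (List.map (λ y → bit (does (N? D x y)) * f y) vertices)
    ≡⟨ sum-vertices n _ ⟩
  ∑ (λ y → bit (does (N? D x y)) * f y)
    ≡⟨ ∑-cong (λ y → cong (λ c → bit c * f y) (does-⇔ (N⇔contains D x y) (N? D x y) (contains? D ∣ x ⊕ y ∣))) ⟩
  ∑ (λ y → indicator D ∣ x ⊕ y ∣ * f y)
    ≡⟨ ∑-shift x _ ⟨
  ∑ (λ z → indicator D ∣ x ⊕ (x ⊕ z) ∣ * f (x ⊕ z))
    ≡⟨ ∑-cong (λ z → cong (λ v → indicator D ∣ v ∣ * f (x ⊕ z)) (⊕-cancelˡ x z)) ⟩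
  ∑ (λ z → indicator D ∣ z ∣ * f (x ⊕ z))
    ∎
  where open FiniteGraph (Q n)

-- A label is 1 plus a binary value. The ones contribute the size of the neighbourhood, `∑ χ`, and
-- the values a sum that is invariant by balance. The magic constant `_` is the last line of the
-- chain.
balanced⇒magic : odd (suc l) ≡ true → (D : Subset m) → Balanced (suc l + suc l) (indicator D) →
                 AdmitsMagicLabeling (Q (suc l + suc l)) D
balanced⇒magic {l} m-odd D bal = f , _ , λ x → begin
  neighbourhoodSum D (label f) x
    ≡⟨ neighbourhoodSum≡∑ D (label f) x ⟩
  ∑ (λ z → χ z * label f (x ⊕ z))
    ≡⟨ ∑-cong (λ z → cong (λ v → χ z * suc v) (toℕ-from (apply (basis l) (x ⊕ z)))) ⟩
  ∑ (λ z → χ z * suc (value (apply (basis l) (x ⊕ z))))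
    ≡⟨ ∑-cong (λ z → *-suc (χ z) (value (apply (basis l) (x ⊕ z)))) ⟩
  ∑ (λ z → χ z + χ z * value (apply (basis l) (x ⊕ z)))
    ≡⟨ ∑-+ χ (λ z → χ z * value (apply (basis l) (x ⊕ z))) ⟩
  ∑ χ + ∑ (λ z → χ z * value (apply (basis l) (x ⊕ z)))
    ≡⟨ cong (∑ χ +_) (∑-value-invariant bal (basis-bisections m-odd) x) ⟩
  ∑ χ + ∑ (λ z → χ z * value (apply (basis l) z))
    ∎
  where
  open FiniteGraph (Q (suc l + suc l))
  f : Vec Bool (suc l + suc l) ⤖ Fin (2 ^ (suc l + suc l))
  f = injective⇒labeling (apply (basis l)) (apply-basis-injective m-odd)
  χ : Vec Bool (suc l + suc l) → ℕ
  χ z = indicator D ∣ z ∣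

-- The distance set

∈-⋃⁺ : {x : Fin n} {p : Subset n} {ps : List (Subset n)} → x ∈ p → p ∈ₗ ps → x ∈ ⋃ ps
∈-⋃⁺ x∈p (here refl)  = x∈p∪q⁺ (inj₁ x∈p)
∈-⋃⁺ x∈p (there p∈ps) = x∈p∪q⁺ (inj₂ (∈-⋃⁺ x∈p p∈ps))

∈-⋃⁻ : {x : Fin n} (ps : List (Subset n)) → x ∈ ⋃ ps → ∃ λ p → p ∈ₗ ps × x ∈ p
∈-⋃⁻ []       x∈⊥ = contradiction x∈⊥ ∉⊥
∈-⋃⁻ (p ∷ ps) x∈  with x∈p∪q⁻ p (⋃ ps) x∈
... | inj₁ x∈p = p , here refl , x∈p
... | inj₂ x∈ps with q , q∈ps , x∈q ← ∈-⋃⁻ ps x∈ps = q , there q∈ps , x∈q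

opposite-∈-mirrorPair : {d : Fin (suc n)} (i : Fin (suc n)) → d ∈ mirrorPair i → opposite d ∈ mirrorPair i
opposite-∈-mirrorPair i d∈ with x∈p∪q⁻ ⁅ i ⁆ ⁅ opposite i ⁆ d∈
... | inj₁ d∈ᵢ with refl ← x∈⁅y⁆⇒x≡y i d∈ᵢ = x∈p∪q⁺ (inj₂ (x∈⁅x⁆ (opposite i)))
... | inj₂ d∈ₒ with refl ← x∈⁅y⁆⇒x≡y (opposite i) d∈ₒ =
  x∈p∪q⁺ (inj₁ (subst (_∈ ⁅ i ⁆) (sym (Fin.opposite-involutive i)) (x∈⁅x⁆ i)))

opposite-∈-⋃ : (I : Subset (suc n)) {d : Fin (suc n)} → d ∈ ⋃[ I ] mirrorPair → opposite d ∈ ⋃[ I ] mirrorPair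
opposite-∈-⋃ {n} I d∈
  with p , p∈ , d∈p ← ∈-⋃⁻ (List.map mirrorPair (List.filter (_∈? I) (allFin (suc n)))) d∈
  with i , _ , refl ← ∈-map⁻ mirrorPair p∈
  = ∈-⋃⁺ (opposite-∈-mirrorPair i d∈p) p∈

-- An even distance cannot come from `E`, so it lies in a mirror pair, and the union of these pairs
-- is closed under `opposite`.
contains-mirror : (E I : Subset (suc n)) → (∀ e → e ∈ E → odd (toℕ e) ≡ true) →
  ∀ {w w′} → w + w′ ≡ n → odd w ≡ false →
  Contains (E ∪ ⋃[ I ] mirrorPair) w → Contains (E ∪ ⋃[ I ] mirrorPair) w′
contains-mirror {n} E I E-odd {w′ = w′} w+w′≡n w-even (d , d∈D , refl) with x∈p∪q⁻ E (⋃[ I ] mirrorPair) d∈D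
... | inj₁ d∈E = contradiction (trans (sym (E-odd d d∈E)) w-even) λ ()
... | inj₂ d∈⋃ = opposite d , x∈p∪q⁺ (inj₂ (opposite-∈-⋃ I d∈⋃)) , (begin
  toℕ (opposite d)        ≡⟨ Fin.opposite-prop d ⟩
  n ∸ toℕ d               ≡⟨ cong (_∸ toℕ d) w+w′≡n ⟨
  toℕ d + w′ ∸ toℕ d      ≡⟨ m+n∸m≡n (toℕ d) w′ ⟩
  w′                      ∎)

-- `contains-mirror` is applied in both directions; the way back requires `w′` to be even, which
-- follows from `n` being even.
indicator-mirror : odd n ≡ false → (E I : Subset (suc n)) → (∀ e → e ∈ E → odd (toℕ e) ≡ true) →
  ∀ w w′ → w + w′ ≡ n → odd w ≡ false →
  indicator (E ∪ ⋃[ I ] mirrorPair) w ≡ indicator (E ∪ ⋃[ I ] mirrorPair) w′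
indicator-mirror {n} n-even E I E-odd w w′ eq w-even = cong bit (does-⇔
  (mk⇔ (contains-mirror E I E-odd eq w-even)
       (contains-mirror E I E-odd (trans (+-comm w′ w) eq) w′-even))
  (contains? _ w) (contains? _ w′))
  where
  w′-even : odd w′ ≡ false
  w′-even = begin
    odd w′             ≡⟨ cong (_xor odd w′) w-even ⟨
    odd w xor odd w′   ≡⟨ odd-+ w w′ ⟨
    odd (w + w′)       ≡⟨ cong odd eq ⟩
    odd n              ≡⟨ n-even ⟩
    false              ∎

-- The form of `n` and the conclusion

%4≡2⇒double-odd : ∀ n → n % 4 ≡ 2 → ∃ λ l → odd (suc l) ≡ true × n ≡ suc l + suc l
-- Here n = 4q + 2, so half of it is the odd number 2q + 1, whose predecessor is the witness.
%4≡2⇒double-odd n n%4≡2 = q + q , cong not (odd-double q) , (begin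
  n                          ≡⟨ m≡m%n+[m/n]*n n 4 ⟩
  n % 4 + q * 4              ≡⟨ cong₂ _+_ n%4≡2 (*-comm q 4) ⟩
  2 + 4 * q                  ≡⟨ regroup q ⟩
  suc (q + q) + suc (q + q)  ∎)
  where
  q : ℕ
  q = n / 4
  regroup : ∀ q → 2 + 4 * q ≡ suc (q + q) + suc (q + q)
  regroup = solve-∀

theorem3p1 : (n : ℕ) → n % 4 ≡ 2 →
    (E : Subset (suc n)) → Nonempty E →
    (∀ e → e ∈ E → toℕ e % 2 ≡ 1 × toℕ e ≤ n ∸ 1) →
    (I : Subset (suc n)) → (∀ i → i ∈ I → toℕ i ≤ n / 2) →
    (∀ i → i ∈ I → Empty (E ∩ mirrorPair i)) →
    AdmitsMagicLabeling (Q n) (E ∪ ⋃[ I ] mirrorPair)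
theorem3p1 n n%4≡2 E _ E-odd I _ _ with %4≡2⇒double-odd n n%4≡2
... | l , m-odd , refl = balanced⇒magic m-odd _ (evenSymmetric⇒balanced n-even
  (indicator-mirror n-even E I (λ e e∈E → %2≡1⇒odd (toℕ e) (proj₁ (E-odd e e∈E)))))
  where
  n-even : odd (suc l + suc l) ≡ false
  n-even = odd-double (suc l)
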